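{- Let $L$ be a finite loop of order $n$, let $d\ge 2$ be an integer, and let $(\psi,\phi)\in\mathcal{C}^2_\delta(L)$. If the matrix $M_\phi$ is Hadamard, then the $d$-dimensional array $H_{\psi,\phi,d}$ is proper Hadamard.
   Context: A loop is a set $L$ with a binary operation (written by juxtaposition, not necessarily associative) having an identity element $e$ and such that for all $a,b\in L$ the equations $ax=b$ and $ya=b$ have unique solutions $x,y\in L$. $\mathcal{C}^2(L)$ is the set of all functions $L\times L\to\mathbb{Z}_2$ ($2$-cochains). $\mathcal{C}^2_\delta(L)$ is the set of $\delta$-compatible pairs, i.e. pairs $(\psi,\phi)\in\mathcal{C}^2(L)\times\mathcal{C}^2(L)$ with $\psi(a,b)+\phi(ab,c)=\phi(a,bc)+\psi(b,c)$ for all $a,b,c\in L$. For $f\in\mathcal{C}^2(L)$, $M_f$ is the $n\times n$ matrix indexed by $L$ with $M_f[a,b]:=(-1)^{f(a,b)}$. For $d\geq 2$, the array $H_{\psi,\phi,d}:L^d\to\{\pm1\}$ is \[H_{\psi,\phi,d}[a_1,\ldots,a_d]:=\left(\prod_{i=2}^{d-1} M_\psi[p_{i-1},a_i]\right)\cdot M_{\phi}[p_{d-1},a_d],\] where $p_1:=a_1$ and $p_i:=p_{i-1}a_i$ for $2\le i<d$ (an empty product is $1$). An $n\times n$ matrix $M$ with entries in $\{ -1,1\}$ is Hadamard if $MM^T=nI_n$. A $d$-dimensional array $H:L^d\to\{\pm1\}$ is proper Hadamard if for all distinct $k,l\in\{1,\ldots,d\}$, all $a,b\in L$ and every choice of the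 remaining coordinates $a_i\in L$ ($i\ne k,l$), one has $\sum_{j\in L}H[\mathbf{x}^{a,j}]\,H[\mathbf{x}^{b,j}]=n\cdot\delta_{ab}$, where $\mathbf{x}^{s,j}\in L^d$ denotes the tuple with $k$-th coordinate $s$, $l$-th coordinate $j$ and $i$-th coordinate $a_i$ for $i\neq k,l$, and $\delta_{ab}$ is the Kronecker delta. -}

module Defs where

open import Algebra.Bundles using (Loop)
open import Data.Bool.Base using (if_then_else_)
open import Data.Fin.Base using (Fin; zero; suc)
open import Data.Fin.Properties using (inj⇒≟)
open import Data.Integer.Base as ℤ using (ℤ; +_; 0ℤ; 1ℤ; _◃_)
open import Data.Integer.Properties using (+-0-monoid)
open import Data.Nat.Base using (ℕ; suc; _≤_; z≤n; s≤s)
open import Data.Parity.Base as ℙ using (Parity; toSign)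
open import Data.Product.Base using (_,_)
open import Data.Product.Relation.Binary.Pointwise.NonDependent using (_×ₛ_)
open import Data.Sign.Base as Sign using (Sign)
open import Data.Sign.Properties using (*-monoid)
open import Data.Vec.Functional using (Vector; init; last; tail; updateAt)
open import Function.Base using (const; flip; _∘_)
open import Function.Bundles using (Func; Inverse; _⟨$⟩_)
open import Function.Properties.Inverse using (Inverse⇒Injection)
import Function.Construct.Symmetry as Symmetry
open import Relation.Binary.Definitions using (Decidable)
open import Relation.Binary.PropositionalEquality using (_≡_; _≢_; setoid)
open import Relation.Nullary.Decidable.Core using (does)

import Algebra.Properties.Monoid.Sum +-0-monoid as Sumℤ
import Algebra.Properties.Monoid.Sum *-monoid as ProdSign

-- An enumeration of a setoid by Fin n exhibits it as finite with exactly n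
-- elements up to its equality.
Enumeration : ∀ {c ℓ} → Loop c ℓ → ℕ → Set _
Enumeration L n = Inverse (setoid (Fin n)) (Loop.setoid L)

module _ {c ℓ} (L : Loop c ℓ) where
  open Loop L using (Carrier; _∙_) renaming (setoid to |L|)

  -- ℤ₂ is Parity.
  Cochain² : Set _
  Cochain² = Func (|L| ×ₛ |L|) (setoid Parity)

  δ-Compatible : Cochain² → Cochain² → Set _
  δ-Compatible ψ φ = ∀ a b c →
    (ψ ⟨$⟩ (a , b)) ℙ.+ (φ ⟨$⟩ (a ∙ b , c)) ≡
    (φ ⟨$⟩ (a , b ∙ c)) ℙ.+ (ψ ⟨$⟩ (b , c))

  Matrix : Set → Set _
  Matrix A = Carrier → Carrier → A

  Array : ℕ → Set _
  Array d = Vector Carrier d → Sign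

  -- toSign is the homomorphism x ↦ (-1)ˣ from ℤ₂ to {±1}.
  M[_] : Cochain² → Matrix Sign
  M[ f ] a b = toSign (f ⟨$⟩ (a , b))

  -- partialProduct a i is (⋯((a₀ a₁) a₂) ⋯) aᵢ; since it only depends on the
  -- coordinates up to i, taking the initial segment in the recursive call
  -- leaves the previous partial product unchanged.
  partialProduct : ∀ {k} → Vector Carrier k → Vector Carrier k
  partialProduct a zero    = a zero
  partialProduct a (suc i) = partialProduct (init a) i ∙ a (suc i)

  -- Coordinates are numbered from 0, so with d = m + 2 the product over
  -- 2 ≤ i ≤ d - 1 becomes one over i : Fin m, whose factor at i has arguments
  -- p i and a (i + 1).
  H : ∀ (ψ φ : Cochain²) (d : ℕ) → 2 ≤ d → Array d
  H ψ φ (suc (suc m)) (s≤s (s≤s z≤n)) a =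
    ProdSign.sum {m} (λ i → M[ ψ ] (init p i) (init (tail a) i))
      Sign.* M[ φ ] (last p) (last a)
    where
    p : Vector Carrier (suc m)
    p = partialProduct (init a)

  module _ {n : ℕ} (enum : Enumeration L n) where
    open Loop L using (_≈_)

    _≈?_ : Decidable _≈_
    _≈?_ = inj⇒≟ (Inverse⇒Injection (Symmetry.inverse enum))

    ∑ : (Carrier → ℤ) → ℤ
    ∑ f = Sumℤ.sum (f ∘ Inverse.to enum)

    -- The Kronecker delta, which is also the identity matrix.
    δ : Matrix ℤ
    δ a b = if does (a ≈? b) then 1ℤ else 0ℤ

    infixl 7 _⊗_

    _⊗_ : Matrix ℤ → Matrix ℤ → Matrix ℤ
    (A ⊗ B) a b = ∑ λ j → A a j ℤ.* B j b

    IsHadamard : Matrix Sign → Set _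
    IsHadamard M = ∀ a b → (Mℤ ⊗ flip Mℤ) a b ≡ + n ℤ.* δ a b
      where
      Mℤ : Matrix ℤ
      Mℤ a b = M a b ◃ 1

    -- The k-th and l-th coordinates of x are overwritten, so x only supplies
    -- the remaining ones.
    IsProperHadamard : ∀ {d} → Array d → Set _
    IsProperHadamard {d} A =
      ∀ (k l : Fin d) → k ≢ l → ∀ (a b : Carrier) (x : Vector Carrier d) →
      let
        x[_,_] : Carrier → Carrier → Vector Carrier d
        x[ s , j ] = updateAt (updateAt x k (const s)) l (const j)
      in
      ∑ (λ j → (A x[ a , j ] ◃ 1) ℤ.* (A x[ b , j ] ◃ 1)) ≡ + n ℤ.* δ a b

{-# OPTIONS --safe #-}

-- Compatibility lets one re-bracket the arguments of H from the right, so that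
-- H[a₁,…,a_d] = M_φ[a₁, a₂(a₃(⋯a_d))] · Ψ(a₂,…,a_d), while splitting off the
-- first factor gives H[a₁,a₂,…] = M_ψ[a₁,a₂] · H[a₁a₂,a₃,…]. Hence for k < l the
-- two-dimensional section of H in the directions k, l is M_φ up to
-- permutations of rows and columns (translations of the loop) and changes of
-- sign of rows and columns, none of which affect orthogonality of rows. The
-- case k > l is the transpose of this one, and Hadamard matrices are closed
-- under transposition.
module Submission where

open import Defs
open import Algebra.Bundles using (Loop)
import Algebra.Properties.CommutativeMonoid.Sum as CMSum
import Algebra.Properties.Monoid.Sum as MonoidSum
import Algebra.Properties.Quasigroup as QuasigroupProperties
import Algebra.Properties.Semiring.Sum as SemiringSum
open import Data.Bool.Base using (true; false; if_then_else_)
open import Data.Fin.Base using (Fin; zero; suc; inject₁; fromℕ; _<_)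
open import Data.Fin.Properties using (_≟_; <-cmp)
open import Data.Integer.Base as ℤ using (ℤ; +_; 0ℤ; 1ℤ; _◃_; _+_; _-_; _*_)
import Data.Integer.Properties as ℤₚ
open import Data.Integer.Tactic.RingSolver using (solve-∀)
open import Data.Nat.Base as ℕ using (ℕ; suc; _≤_; z≤n; s≤s; s<s⁻¹)
open import Data.Parity.Base using (toSign)
open import Data.Parity.Properties using (+-homo-*)
open import Data.Product.Base using (_,_; Σ-syntax)
open import Data.Sign.Base as Sign using (Sign)
import Data.Sign.Properties as Signₚ
open import Data.Sum.Base using ([_,_]′)
open import Data.Vec.Functional using (Vector; init; tail; updateAt; _∷_)
open import Data.Vec.Functional.Properties using (updateAt-commutes)
open import Function.Base using (const; flip; id; _∘_)
open import Function.Bundles using (Func; Inverse; _⟨$⟩_; mk⇔)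
open import Function.Definitions using (Congruent; Injective)
import Function.Construct.Composition as Composition
import Function.Construct.Identity as Identity
import Function.Construct.Symmetry as Symmetry
open import Relation.Binary.Definitions using (tri<; tri≈; tri>)
open import Relation.Binary.PropositionalEquality
  using (_≡_; refl; sym; trans; cong; cong₂; ≢-sym; module ≡-Reasoning)
open import Relation.Nullary.Decidable using (Dec; does; yes; no; does-⇔)
open import Relation.Nullary.Negation using (contradiction)

open SemiringSum ℤₚ.+-*-semiring
  using (sum; sum-cong-≗; sum-replicate-zero; *-distribˡ-sum; *-distribʳ-sum)
open CMSum ℤₚ.+-0-commutativeMonoid using (∑-comm; ∑-distrib-+; sum-permute)

open ≡-Reasoning

-- Sums of nonnegative integers.

i*i≥0 : ∀ i → 0ℤ ℤ.≤ i * i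
i*i≥0 (+ ℕ.zero)  = ℤ.+≤+ z≤n
i*i≥0 (+ suc _)   = ℤ.+≤+ z≤n
i*i≥0 (ℤ.-[1+ _ ]) = ℤ.+≤+ z≤n

sum-nonNeg : ∀ {n} (f : Vector ℤ n) → (∀ i → 0ℤ ℤ.≤ f i) → 0ℤ ℤ.≤ sum f
sum-nonNeg {ℕ.zero} f f≥0 = ℤₚ.≤-refl
sum-nonNeg {suc n}  f f≥0 = ℤₚ.+-mono-≤ (f≥0 zero) (sum-nonNeg (tail f) (f≥0 ∘ suc))

-- The sum of the tail is nonnegative, so the head is at most the total `0ℤ`; once the head
-- vanishes, the tail again sums to `0ℤ`. Needed for the vanishing sum of squares `C-norm`.
sum-nonNeg≡0 : ∀ {n} (f : Vector ℤ n) → (∀ i → 0ℤ ℤ.≤ f i) → sum f ≡ 0ℤ → ∀ i → f i ≡ 0ℤ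
sum-nonNeg≡0 f f≥0 ∑f≡0 zero = ℤₚ.≤-antisym f₀≤0 (f≥0 zero)
  where
  f₀≤0 : f zero ℤ.≤ 0ℤ
  f₀≤0 = ℤₚ.≤-trans (ℤₚ.≤-reflexive (sym (ℤₚ.+-identityʳ _)))
    (ℤₚ.≤-trans (ℤₚ.+-monoʳ-≤ (f zero) (sum-nonNeg (tail f) (f≥0 ∘ suc))) (ℤₚ.≤-reflexive ∑f≡0))
sum-nonNeg≡0 f f≥0 ∑f≡0 (suc i) = sum-nonNeg≡0 (tail f) (f≥0 ∘ suc) ∑t≡0 i
  where
  ∑t≡0 : sum (tail f) ≡ 0ℤ
  ∑t≡0 = begin
    sum (tail f)           ≡⟨ ℤₚ.+-identityˡ _ ⟨
    0ℤ + sum (tail f)      ≡⟨ cong (λ s → s + sum (tail f)) (sum-nonNeg≡0 f f≥0 ∑f≡0 zero) ⟨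
    f zero + sum (tail f)  ≡⟨ ∑f≡0 ⟩
    0ℤ                     ∎

sum-replicate-1 : ∀ n → sum {n} (const 1ℤ) ≡ + n
sum-replicate-1 ℕ.zero  = refl
sum-replicate-1 (suc n) = cong ℤ.suc (sum-replicate-1 n)

-- The Kronecker delta on indices.

𝟙 : ∀ {n} → Fin n → Fin n → ℤ
𝟙 i j = if does (i ≟ j) then 1ℤ else 0ℤ

𝟙-diagonal : ∀ {n} (i : Fin n) → 𝟙 i i ≡ 1ℤ
𝟙-diagonal zero    = refl
𝟙-diagonal (suc i) = 𝟙-diagonal i

𝟙-idem : ∀ {n} (i j : Fin n) → 𝟙 i j * 𝟙 i j ≡ 𝟙 i j
𝟙-idem i j with does (i ≟ j)
... | true  = refl
... | false = refl

sum-𝟙 : ∀ {n} (f : Vector ℤ n) i → sum (λ j → f j * 𝟙 i j) ≡ f i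
sum-𝟙 {suc n} f zero = begin
  f zero * 1ℤ + sum (λ j → f (suc j) * 0ℤ)
    ≡⟨ cong₂ _+_ (ℤₚ.*-identityʳ (f zero)) (sum-cong-≗ (λ j → ℤₚ.*-zeroʳ (f (suc j)))) ⟩
  f zero + sum {n} (const 0ℤ)  ≡⟨ cong (λ s → f zero + s) (sum-replicate-zero n) ⟩
  f zero + 0ℤ                  ≡⟨ ℤₚ.+-identityʳ _ ⟩
  f zero                       ∎
sum-𝟙 {suc n} f (suc i) = begin
  f zero * 0ℤ + sum (λ j → f (suc j) * 𝟙 i j)
    ≡⟨ cong₂ _+_ (ℤₚ.*-zeroʳ (f zero)) (sum-𝟙 (tail f) i) ⟩
  0ℤ + f (suc i)  ≡⟨ ℤₚ.+-identityˡ _ ⟩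
  f (suc i)       ∎

-- Orthogonality of the columns. With B = AᵀA one has AB = (AAᵀ)A = nA, so row j
-- of B has square norm n² = B[j,j]² and ∑ₖ (B[j,k] - n δⱼₖ)² = n² - 2n·n + n² = 0.
module _ {n : ℕ} (A : Fin n → Fin n → ℤ)
  (±1 : ∀ i j → A i j * A i j ≡ 1ℤ)
  (rows : ∀ i k → sum (λ j → A i j * A k j) ≡ + n * 𝟙 i k) where

  private
    B : Fin n → Fin n → ℤ
    B j k = sum (λ i → A i j * A i k)

    B-diagonal : ∀ j → B j j ≡ + n
    B-diagonal j = trans (sum-cong-≗ (λ i → ±1 i j)) (sum-replicate-1 n)

    A*B : ∀ i j → sum (λ k → A i k * B j k) ≡ + n * A i j
    A*B i j = begin
      sum (λ k → A i k * B j k)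
        ≡⟨ sum-cong-≗ (λ k → *-distribˡ-sum (A i k) (λ i′ → A i′ j * A i′ k)) ⟩
      sum (λ k → sum (λ i′ → A i k * (A i′ j * A i′ k)))
        -- Exchanging the sums turns A(AᵀA) into (AAᵀ)A, to which `rows` applies.
        ≡⟨ ∑-comm (λ k i′ → A i k * (A i′ j * A i′ k)) ⟩
      sum (λ i′ → sum (λ k → A i k * (A i′ j * A i′ k)))
        ≡⟨ sum-cong-≗ (λ i′ → sum-cong-≗ (λ k → swap (A i k) (A i′ j) (A i′ k))) ⟩
      sum (λ i′ → sum (λ k → A i′ j * (A i k * A i′ k)))
        ≡⟨ sum-cong-≗ (λ i′ → *-distribˡ-sum (A i′ j) (λ k → A i k * A i′ k)) ⟨
      sum (λ i′ → A i′ j * sum (λ k → A i k * A i′ k))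
        ≡⟨ sum-cong-≗ (λ i′ → trans (cong (A i′ j *_) (rows i i′)) (pull (A i′ j) (+ n) (𝟙 i i′))) ⟩
      sum (λ i′ → (+ n * A i′ j) * 𝟙 i i′)
        ≡⟨ sum-𝟙 (λ i′ → + n * A i′ j) i ⟩
      + n * A i j ∎
      where
      swap : ∀ x y z → x * (y * z) ≡ y * (x * z)
      swap = solve-∀
      pull : ∀ x y z → x * (y * z) ≡ y * x * z
      pull = solve-∀

    B-norm : ∀ j → sum (λ k → B j k * B j k) ≡ + n * + n
    B-norm j = begin
      sum (λ k → B j k * B j k)
        -- Only one of the two factors is expanded; the other is kept so that `A*B` can evaluate the
        -- inner sum.
        ≡⟨ sum-cong-≗ (λ k → *-distribʳ-sum (B j k) (λ i → A i j * A i k)) ⟩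
      sum (λ k → sum (λ i → A i j * A i k * B j k))
        ≡⟨ ∑-comm (λ k i → A i j * A i k * B j k) ⟩
      sum (λ i → sum (λ k → A i j * A i k * B j k))
        ≡⟨ sum-cong-≗ (λ i → trans
             (sum-cong-≗ (λ k → ℤₚ.*-assoc (A i j) (A i k) (B j k)))
             (sym (*-distribˡ-sum (A i j) (λ k → A i k * B j k)))) ⟩
      sum (λ i → A i j * sum (λ k → A i k * B j k))
        ≡⟨ sum-cong-≗ (λ i → trans (cong (A i j *_) (A*B i j)) (swap (A i j) (+ n))) ⟩
      sum (λ i → + n * (A i j * A i j))
        ≡⟨ *-distribˡ-sum (+ n) (λ i → A i j * A i j) ⟨
      + n * B j j
        ≡⟨ cong (+ n *_) (B-diagonal j) ⟩
      + n * + n ∎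
      where
      swap : ∀ x y → x * (y * x) ≡ y * (x * x)
      swap = solve-∀

    C : Fin n → Fin n → ℤ
    C j k = B j k - + n * 𝟙 j k

    -- The total coefficient of `𝟙 j k` in the square of `C j k`: since `𝟙` is idempotent, the
    -- linear and quadratic terms merge, and `sum-𝟙` then picks out `k = j`.
    g : Fin n → Fin n → ℤ
    g j k = + n * + n - (+ n * B j k + + n * B j k)

    C-norm : ∀ j → sum (λ k → C j k * C j k) ≡ 0ℤ
    C-norm j = begin
      sum (λ k → C j k * C j k)
        ≡⟨ sum-cong-≗ (λ k → trans (expand (B j k) (+ n) (𝟙 j k))
             (trans (cong (λ t → B j k * B j k + (+ n * + n * t - (+ n * B j k + + n * B j k) * 𝟙 j k)) (𝟙-idem j k))
                    (collect (B j k) (+ n) (𝟙 j k)))) ⟩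
      sum (λ k → B j k * B j k + g j k * 𝟙 j k)
        ≡⟨ ∑-distrib-+ (λ k → B j k * B j k) (λ k → g j k * 𝟙 j k) ⟩
      sum (λ k → B j k * B j k) + sum (λ k → g j k * 𝟙 j k)
        ≡⟨ cong₂ _+_ (B-norm j) (sum-𝟙 (g j) j) ⟩
      + n * + n + g j j
        ≡⟨ cong (λ t → + n * + n + (+ n * + n - (+ n * t + + n * t))) (B-diagonal j) ⟩
      + n * + n + (+ n * + n - (+ n * + n + + n * + n))
        ≡⟨ cancel (+ n) ⟩
      0ℤ ∎
      where
      expand : ∀ b m t → (b - m * t) * (b - m * t) ≡ b * b + (m * m * (t * t) - (m * b + m * b) * t)
      expand = solve-∀
      collect : ∀ b m t → b * b + (m * m * t - (m * b + m * b) * t) ≡ b * b + (m * m - (m * b + m * b)) * t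
      collect = solve-∀
      cancel : ∀ m → m * m + (m * m - (m * m + m * m)) ≡ 0ℤ
      cancel = solve-∀

  orthogonalRows⇒orthogonalColumns : ∀ j k → sum (λ i → A i j * A i k) ≡ + n * 𝟙 j k
  -- Both factors are `C j k`, so either alternative of the zero-product law yields the same
  -- equation.
  orthogonalRows⇒orthogonalColumns j k = ℤₚ.i-j≡0⇒i≡j (B j k) _ ([ id , id ]′ (ℤₚ.i*j≡0⇒i≡0∨j≡0 (C j k)
    (sum-nonNeg≡0 (λ k′ → C j k′ * C j k′) (λ k′ → i*i≥0 (C j k′)) (C-norm j) k)))

-- Signs as integers.

⟦_⟧ : Sign → ℤ
⟦ s ⟧ = s ◃ 1

⟦⟧-homo-* : ∀ s t → ⟦ s Sign.* t ⟧ ≡ ⟦ s ⟧ * ⟦ t ⟧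
⟦⟧-homo-* s t = ℤₚ.◃-distrib-* s t 1 1

⟦⟧-square : ∀ s → ⟦ s ⟧ * ⟦ s ⟧ ≡ 1ℤ
⟦⟧-square Sign.+ = refl
⟦⟧-square Sign.- = refl

-- Operations preserving the Hadamard property.

module _ {c ℓ} (L : Loop c ℓ) {n : ℕ} (enum : Enumeration L n) where
  open Loop L using (Carrier; _≈_) renaming (setoid to |L|)
  open Inverse enum using (to; from; to-cong; from-cong; strictlyInverseˡ; strictlyInverseʳ)

  hadamard-cong : ∀ {N N′ : Matrix L Sign} → (∀ a b → N′ a b ≡ N a b) →
                  IsHadamard L enum N → IsHadamard L enum N′
  hadamard-cong N′≡N hadamard a b = trans
    (sum-cong-≗ (λ j → cong₂ (λ s t → ⟦ s ⟧ * ⟦ t ⟧) (N′≡N a (to j)) (N′≡N b (to j))))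
    (hadamard a b)

  -- Reduces to integer matrices indexed by `Fin n`: congruence replaces `a` and `b` by their
  -- enumerated representatives, and orthogonality of columns applies there.
  hadamard-transpose : ∀ {N : Matrix L Sign} →
                       (∀ a → Congruent _≈_ _≡_ (N a)) →
                       IsHadamard L enum N → IsHadamard L enum (flip N)
  hadamard-transpose {N} N-cong hadamard a b = begin
    sum (λ i → ⟦ N (to i) a ⟧ * ⟦ N (to i) b ⟧)
      ≡⟨ sum-cong-≗ (λ i → cong₂ (λ s t → ⟦ s ⟧ * ⟦ t ⟧)
           (N-cong (to i) (Loop.sym L (strictlyInverseˡ a)))
           (N-cong (to i) (Loop.sym L (strictlyInverseˡ b)))) ⟩
    sum (λ i → ⟦ N (to i) (to (from a)) ⟧ * ⟦ N (to i) (to (from b)) ⟧)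
      ≡⟨ orthogonalRows⇒orthogonalColumns (λ i j → ⟦ N (to i) (to j) ⟧)
           (λ i j → ⟦⟧-square (N (to i) (to j))) rows (from a) (from b) ⟩
    + n * δ L enum a b ∎
    where
    rows : ∀ i k → sum (λ j → ⟦ N (to i) (to j) ⟧ * ⟦ N (to k) (to j) ⟧) ≡ + n * 𝟙 i k
    -- Decidable equality on the loop compares images under `from`, so `δ L enum a b` computes to
    -- `𝟙 (from a) (from b)`.
    rows i k = trans (hadamard (to i) (to k))
      (cong₂ (λ i k → + n * 𝟙 i k) (strictlyInverseʳ i) (strictlyInverseʳ k))

  -- The signs of two rows factor out of their inner product: for distinct rows they multiply zero,
  -- for equal rows they square to one. As `u` preserves and reflects equality, it leaves `δ`
  -- unchanged.
  hadamard-rows : ∀ {N N′ : Matrix L Sign} (r : Carrier → Sign) (u : Carrier → Carrier) →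
                  Congruent _≈_ _≡_ r → Congruent _≈_ _≈_ u → Injective _≈_ _≈_ u →
                  (∀ a b → N′ a b ≡ r a Sign.* N (u a) b) →
                  IsHadamard L enum N → IsHadamard L enum N′
  hadamard-rows {N} {N′} r u r-cong u-cong u-inj N′≡ hadamard a b = begin
    sum (λ j → ⟦ N′ a (to j) ⟧ * ⟦ N′ b (to j) ⟧)
      ≡⟨ sum-cong-≗ (λ j → trans
           (cong₂ _*_ (factor a (to j)) (factor b (to j)))
           (interchange ⟦ r a ⟧ ⟦ N (u a) (to j) ⟧ ⟦ r b ⟧ ⟦ N (u b) (to j) ⟧)) ⟩
    sum (λ j → ⟦ r a ⟧ * ⟦ r b ⟧ * (⟦ N (u a) (to j) ⟧ * ⟦ N (u b) (to j) ⟧))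
      ≡⟨ *-distribˡ-sum (⟦ r a ⟧ * ⟦ r b ⟧) (λ j → ⟦ N (u a) (to j) ⟧ * ⟦ N (u b) (to j) ⟧) ⟨
    ⟦ r a ⟧ * ⟦ r b ⟧ * sum (λ j → ⟦ N (u a) (to j) ⟧ * ⟦ N (u b) (to j) ⟧)
      ≡⟨ cong (⟦ r a ⟧ * ⟦ r b ⟧ *_) (hadamard (u a) (u b)) ⟩
    ⟦ r a ⟧ * ⟦ r b ⟧ * (+ n * δ L enum (u a) (u b))
      ≡⟨ cong (λ t → ⟦ r a ⟧ * ⟦ r b ⟧ * (+ n * (if t then 1ℤ else 0ℤ)))
           (does-⇔ (mk⇔ u-inj u-cong) (_≈?_ L enum (u a) (u b)) (_≈?_ L enum a b)) ⟩
    ⟦ r a ⟧ * ⟦ r b ⟧ * (+ n * δ L enum a b)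
      ≡⟨ absorb (_≈?_ L enum a b) ⟩
    + n * δ L enum a b ∎
    where
    factor : ∀ a b → ⟦ N′ a b ⟧ ≡ ⟦ r a ⟧ * ⟦ N (u a) b ⟧
    factor a b = trans (cong ⟦_⟧ (N′≡ a b)) (⟦⟧-homo-* (r a) (N (u a) b))

    interchange : ∀ w x y z → (w * x) * (y * z) ≡ w * y * (x * z)
    interchange = solve-∀

    -- Stated for an arbitrary decision so that matching on it reduces the conditional on both
    -- sides.
    absorb : (a≈?b : Dec (a ≈ b)) → let 𝟙ab = if does a≈?b then 1ℤ else 0ℤ in
             ⟦ r a ⟧ * ⟦ r b ⟧ * (+ n * 𝟙ab) ≡ + n * 𝟙ab
    absorb (yes a≈b) = begin
      ⟦ r a ⟧ * ⟦ r b ⟧ * (+ n * 1ℤ)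
        ≡⟨ cong (λ s → ⟦ s ⟧ * ⟦ r b ⟧ * (+ n * 1ℤ)) (r-cong a≈b) ⟩
      ⟦ r b ⟧ * ⟦ r b ⟧ * (+ n * 1ℤ)  ≡⟨ cong (_* (+ n * 1ℤ)) (⟦⟧-square (r b)) ⟩
      1ℤ * (+ n * 1ℤ)                 ≡⟨ ℤₚ.*-identityˡ _ ⟩
      + n * 1ℤ                        ∎
    absorb (no _) = begin
      ⟦ r a ⟧ * ⟦ r b ⟧ * (+ n * 0ℤ)  ≡⟨ cong (⟦ r a ⟧ * ⟦ r b ⟧ *_) (ℤₚ.*-zeroʳ (+ n)) ⟩
      ⟦ r a ⟧ * ⟦ r b ⟧ * 0ℤ          ≡⟨ ℤₚ.*-zeroʳ (⟦ r a ⟧ * ⟦ r b ⟧) ⟩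
      0ℤ                              ≡⟨ ℤₚ.*-zeroʳ (+ n) ⟨
      + n * 0ℤ                        ∎

  -- A column sign occurs in both rows and squares away, while `v` merely reorders the terms of the
  -- inner product.
  hadamard-columns : ∀ {N N′ : Matrix L Sign} (c : Carrier → Sign) (v : Inverse |L| |L|) →
                     (∀ a → Congruent _≈_ _≡_ (N a)) →
                     (∀ a b → N′ a b ≡ N a (Inverse.to v b) Sign.* c b) →
                     IsHadamard L enum N → IsHadamard L enum N′
  hadamard-columns {N} {N′} c v N-cong N′≡ hadamard a b = begin
    sum (λ j → ⟦ N′ a (to j) ⟧ * ⟦ N′ b (to j) ⟧)
      ≡⟨ sum-cong-≗ (λ j → trans
           (cong₂ _*_ (factor a (to j)) (factor b (to j)))
           (cancel ⟦ N a (Inverse.to v (to j)) ⟧ (c (to j)) ⟦ N b (Inverse.to v (to j)) ⟧)) ⟩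
    sum (λ j → ⟦ N a (Inverse.to v (to j)) ⟧ * ⟦ N b (Inverse.to v (to j)) ⟧)
      ≡⟨ sum-cong-≗ (λ j → cong₂ (λ s t → ⟦ s ⟧ * ⟦ t ⟧)
           (N-cong a (Loop.sym L (strictlyInverseˡ (Inverse.to v (to j)))))
           (N-cong b (Loop.sym L (strictlyInverseˡ (Inverse.to v (to j)))))) ⟩
    sum (λ j → ⟦ N a (to (Inverse.to π j)) ⟧ * ⟦ N b (to (Inverse.to π j)) ⟧)
      ≡⟨ sum-permute (λ j → ⟦ N a (to j) ⟧ * ⟦ N b (to j) ⟧) π ⟨
    sum (λ j → ⟦ N a (to j) ⟧ * ⟦ N b (to j) ⟧)
      ≡⟨ hadamard a b ⟩
    + n * δ L enum a b ∎
    where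
    -- The permutation `v` carried over to `Fin n` along the enumeration, as reindexing a finite sum
    -- requires.
    π = Composition.inverse enum (Composition.inverse v (Symmetry.inverse enum))

    factor : ∀ a b → ⟦ N′ a b ⟧ ≡ ⟦ N a (Inverse.to v b) ⟧ * ⟦ c b ⟧
    factor a b = trans (cong ⟦_⟧ (N′≡ a b)) (⟦⟧-homo-* (N a (Inverse.to v b)) (c b))

    regroup : ∀ x y z → (x * y) * (z * y) ≡ y * y * (x * z)
    regroup = solve-∀

    cancel : ∀ x s z → (x * ⟦ s ⟧) * (z * ⟦ s ⟧) ≡ x * z
    cancel x s z = begin
      (x * ⟦ s ⟧) * (z * ⟦ s ⟧)  ≡⟨ regroup x ⟦ s ⟧ z ⟩
      ⟦ s ⟧ * ⟦ s ⟧ * (x * z)    ≡⟨ cong (_* (x * z)) (⟦⟧-square s) ⟩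
      1ℤ * (x * z)               ≡⟨ ℤₚ.*-identityˡ _ ⟩
      x * z                      ∎

-- Translations and iterated products in a loop.

module _ {c ℓ} (L : Loop c ℓ) where
  open QuasigroupProperties (Loop.quasigroup L) using (cancelˡ)
  open Loop L using (Carrier; _≈_; _∙_; _\\_; _//_; ∙-cong; ∙-congˡ; ∙-congʳ;
    \\-congˡ; //-congʳ; leftDividesˡ; leftDividesʳ; rightDividesˡ; rightDividesʳ)
    renaming (setoid to |L|; refl to ≈-refl; sym to ≈-sym; trans to ≈-trans)

  leftTranslation : Carrier → Inverse |L| |L|
  leftTranslation a = record
    { to        = a ∙_
    ; from      = a \\_
    ; to-cong   = ∙-congˡ
    ; from-cong = \\-congˡ
    ; inverse   = (λ {x} y≈ → ≈-trans (∙-congˡ y≈) (leftDividesˡ a x))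
                , (λ {x} y≈ → ≈-trans (\\-congˡ y≈) (leftDividesʳ a x))
    }

  rightTranslation : Carrier → Inverse |L| |L|
  rightTranslation a = record
    { to        = _∙ a
    ; from      = _// a
    ; to-cong   = ∙-congʳ
    ; from-cong = //-congʳ
    ; inverse   = (λ {x} y≈ → ≈-trans (∙-congʳ y≈) (rightDividesˡ a x))
                , (λ {x} y≈ → ≈-trans (//-congʳ y≈) (rightDividesʳ a x))
    }

  M-cong : (f : Cochain² L) → ∀ {a a′ b b′} → a ≈ a′ → b ≈ b′ → M[_] L f a b ≡ M[_] L f a′ b′
  M-cong f a≈a′ b≈b′ = cong toSign (Func.cong f (a≈a′ , b≈b′))

  -- The contraction that drives the inductions on dimension.
  mergeFirst : ∀ {k} → Vector Carrier (2 ℕ.+ k) → Vector Carrier (1 ℕ.+ k)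
  mergeFirst a = (a zero ∙ a (suc zero)) ∷ tail (tail a)

  partialProduct-cong : ∀ {k} {a b : Vector Carrier k} → (∀ i → a i ≈ b i) →
                        ∀ i → partialProduct L a i ≈ partialProduct L b i
  partialProduct-cong a≈b zero    = a≈b zero
  partialProduct-cong a≈b (suc i) = ∙-cong (partialProduct-cong (a≈b ∘ inject₁) i) (a≈b (suc i))

  init-mergeFirst : ∀ {k} (a : Vector Carrier (3 ℕ.+ k)) i →
                    mergeFirst (init a) i ≈ init (mergeFirst a) i
  init-mergeFirst a zero    = ≈-refl
  init-mergeFirst a (suc i) = ≈-refl

  -- Left-nested products multiply the first two entries first anyway. The recursion of
  -- `partialProduct` shortens the vector at the other end, so `init` has to be commuted with
  -- `mergeFirst`, which holds pointwise.
  partialProduct-mergeFirst : ∀ {k} (a : Vector Carrier (2 ℕ.+ k)) i →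
    partialProduct L a (suc i) ≈ partialProduct L (mergeFirst a) i
  partialProduct-mergeFirst a zero = ≈-refl
  partialProduct-mergeFirst {suc k} a (suc i) = ∙-congʳ (≈-trans
    (partialProduct-mergeFirst (init a) i)
    (partialProduct-cong (init-mergeFirst a) i))

  updateAt-const-cong : ∀ {m} (x : Vector Carrier m) l {a b} → a ≈ b →
                        ∀ i → updateAt x l (const a) i ≈ updateAt x l (const b) i
  updateAt-const-cong x zero    a≈b zero    = a≈b
  updateAt-const-cong x zero    a≈b (suc i) = ≈-refl
  updateAt-const-cong x (suc l) a≈b zero    = ≈-refl
  updateAt-const-cong x (suc l) a≈b (suc i) = updateAt-const-cong (tail x) l a≈b i

  overwrite : ∀ {d} (k l : Fin d) → Vector Carrier d → Carrier → Carrier → Vector Carrier d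
  overwrite k l x s j = updateAt (updateAt x k (const s)) l (const j)

  -- Here the overwritten row coordinate is itself merged, so the row index is left-translated by
  -- `x zero`.
  mergeFirst-overwrite₁ : ∀ {m} l (x : Vector Carrier (2 ℕ.+ m)) s j i →
    mergeFirst (overwrite (suc zero) (suc (suc l)) x s j) i ≈
    overwrite zero (suc l) (mergeFirst x) (x zero ∙ s) j i
  mergeFirst-overwrite₁ l x s j zero    = ≈-refl
  mergeFirst-overwrite₁ l x s j (suc i) = ≈-refl

  mergeFirst-overwrite₂ : ∀ {m} k l (x : Vector Carrier (2 ℕ.+ m)) s j i →
    mergeFirst (overwrite (suc (suc k)) (suc (suc l)) x s j) i ≈
    overwrite (suc k) (suc l) (mergeFirst x) s j i
  mergeFirst-overwrite₂ k l x s j zero    = ≈-refl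
  mergeFirst-overwrite₂ k l x s j (suc i) = ≈-refl

  rightProduct : ∀ {m} → Vector Carrier (suc m) → Carrier
  rightProduct {ℕ.zero} y = y zero
  rightProduct {suc m}  y = y zero ∙ rightProduct (tail y)

  -- The varying entry is right-translated by the product of the entries after it, if any, and then
  -- left-translated by each earlier entry; in a loop all translations are invertible.
  rightProduct-updateAt : ∀ {m} (y : Vector Carrier (suc m)) (l : Fin (suc m)) →
    Σ[ v ∈ Inverse |L| |L| ] (∀ j → rightProduct (updateAt y l (const j)) ≈ Inverse.to v j)
  rightProduct-updateAt {ℕ.zero} y zero    = Identity.inverse |L| , λ j → ≈-refl
  rightProduct-updateAt {suc m}  y zero    = rightTranslation (rightProduct (tail y)) , λ j → ≈-refl
  rightProduct-updateAt {suc m}  y (suc l) =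
    let v , rightProduct≈v = rightProduct-updateAt (tail y) l in
    Composition.inverse v (leftTranslation (y zero)) , λ j → ∙-congˡ (rightProduct≈v j)

  -- Recursion and re-bracketing for `H`.

  module _ (ψ φ : Cochain² L) where
    private
      Mψ Mφ : Matrix L Sign
      Mψ = M[_] L ψ
      Mφ = M[_] L φ

      -- The bound is given in constructor form, on which `H` reduces.
      Hᵈ : ∀ {m} → Array L (2 ℕ.+ m)
      Hᵈ {m} = H L ψ φ (2 ℕ.+ m) (s≤s (s≤s z≤n))

      module SignSum = MonoidSum Signₚ.*-monoid

    H-cong : ∀ {m} {a b : Vector Carrier (2 ℕ.+ m)} → (∀ i → a i ≈ b i) → Hᵈ a ≡ Hᵈ b
    H-cong {m} a≈b = cong₂ Sign._*_
      (SignSum.sum-cong-≗ (λ i → M-cong ψ (p≈ (inject₁ i)) (a≈b (suc (inject₁ i)))))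
      (M-cong φ (p≈ (fromℕ m)) (a≈b (suc (fromℕ m))))
      where
      p≈ = partialProduct-cong (a≈b ∘ inject₁)

    -- The factor at index zero is split off; the others involve only later partial products and
    -- later coordinates, which merging preserves.
    H-mergeFirst : ∀ {m} (a : Vector Carrier (3 ℕ.+ m)) →
                   Hᵈ a ≡ Mψ (a zero) (a (suc zero)) Sign.* Hᵈ (mergeFirst a)
    H-mergeFirst {m} a = trans
      (Signₚ.*-assoc (Mψ (a zero) (a (suc zero))) _ _)
      (cong (Mψ (a zero) (a (suc zero)) Sign.*_) (cong₂ Sign._*_
        (SignSum.sum-cong-≗ (λ i → M-cong ψ (p≈ (inject₁ i)) ≈-refl))
        (M-cong φ (p≈ (fromℕ m)) ≈-refl)))
      where
      p≈ : ∀ i → partialProduct L (init a) (suc i) ≈ partialProduct L (init (mergeFirst a)) i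
      p≈ i = ≈-trans (partialProduct-mergeFirst (init a) i)
                     (partialProduct-cong (init-mergeFirst a) i)

    -- The factor Ψ: the entries of `Mψ` left over from successive re-bracketings. A single entry
    -- needs none, hence `Sign.+`.
    rightSign : ∀ {m} → Vector Carrier (suc m) → Sign
    rightSign {ℕ.zero} y = Sign.+
    rightSign {suc m}  y = Mψ (y zero) (rightProduct (tail y)) Sign.* rightSign (tail y)

    module _ (compatible : δ-Compatible L ψ φ) where

      M-compatible : ∀ a b c → Mψ a b Sign.* Mφ (a ∙ b) c ≡ Mφ a (b ∙ c) Sign.* Mψ b c
      M-compatible a b c = begin
        Mψ a b Sign.* Mφ (a ∙ b) c  ≡⟨ +-homo-* (ψ ⟨$⟩ (a , b)) (φ ⟨$⟩ (a ∙ b , c)) ⟨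
        _                           ≡⟨ cong toSign (compatible a b c) ⟩
        _                           ≡⟨ +-homo-* (φ ⟨$⟩ (a , b ∙ c)) (ψ ⟨$⟩ (b , c)) ⟩
        Mφ a (b ∙ c) Sign.* Mψ b c  ∎

      -- By induction after merging: compatibility at `a₀`, `a₁` and the right product of the rest
      -- trades `Mψ a₀ a₁` for a sign free of `a₀`, so that `a₀` survives only as a row index of
      -- `Mφ`.
      H-rightProduct : ∀ {m} (a : Vector Carrier (2 ℕ.+ m)) →
        Hᵈ a ≡ Mφ (a zero) (rightProduct (tail a)) Sign.* rightSign (tail a)
      H-rightProduct {ℕ.zero} a = sym (Signₚ.*-identityʳ _)
      H-rightProduct {suc m}  a = begin
        Hᵈ a
          ≡⟨ H-mergeFirst a ⟩
        Mψ a₀ a₁ Sign.* Hᵈ (mergeFirst a)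
          ≡⟨ cong (Mψ a₀ a₁ Sign.*_) (H-rightProduct (mergeFirst a)) ⟩
        Mψ a₀ a₁ Sign.* (Mφ (a₀ ∙ a₁) (rightProduct y) Sign.* rightSign y)
          ≡⟨ Signₚ.*-assoc (Mψ a₀ a₁) _ _ ⟨
        Mψ a₀ a₁ Sign.* Mφ (a₀ ∙ a₁) (rightProduct y) Sign.* rightSign y
          ≡⟨ cong (Sign._* rightSign y) (M-compatible a₀ a₁ (rightProduct y)) ⟩
        Mφ a₀ (a₁ ∙ rightProduct y) Sign.* Mψ a₁ (rightProduct y) Sign.* rightSign y
          ≡⟨ Signₚ.*-assoc (Mφ a₀ (a₁ ∙ rightProduct y)) _ _ ⟩
        Mφ a₀ (a₁ ∙ rightProduct y) Sign.* (Mψ a₁ (rightProduct y) Sign.* rightSign y) ∎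
        where
        a₀ = a zero
        a₁ = a (suc zero)
        y  = tail (tail a)

      -- Two-dimensional sections.

      module _ {n : ℕ} (enum : Enumeration L n) (hadamard : IsHadamard L enum Mφ) where

        section : ∀ {m} (k l : Fin (2 ℕ.+ m)) → Vector Carrier (2 ℕ.+ m) → Matrix L Sign
        section k l x s j = Hᵈ (overwrite k l x s j)

        section-hadamard : ∀ {m} (k l : Fin (2 ℕ.+ m)) → k < l → ∀ x →
                           IsHadamard L enum (section k l x)
        -- The row index is already the first coordinate; `j` enters through an invertible map of
        -- the columns and through a sign depending on `j` alone.
        section-hadamard zero (suc l) _ x =
          let v , rightProduct≈v = rightProduct-updateAt (tail x) l in
          hadamard-columns L enum {N = Mφ} {N′ = section zero (suc l) x}
            (λ j → rightSign (updateAt (tail x) l (const j))) v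
            (λ a → M-cong φ ≈-refl)
            (λ s j → trans
              (H-rightProduct (overwrite zero (suc l) x s j))
              (cong (Sign._* rightSign (updateAt (tail x) l (const j)))
                (M-cong φ ≈-refl (rightProduct≈v j))))
            hadamard
        section-hadamard {ℕ.zero} (suc zero) (suc zero) (s≤s ()) x
        section-hadamard {suc m} (suc _) (suc zero) (s≤s ()) x
        -- The row coordinate is absorbed by merging: row `s` becomes row `x zero ∙ s`, with a sign
        -- depending on `s` alone.
        section-hadamard {suc m} (suc zero) (suc (suc l)) _ x =
          hadamard-rows L enum
            {N = section zero (suc l) (mergeFirst x)} {N′ = section (suc zero) (suc (suc l)) x}
            (Mψ (x zero)) (x zero ∙_)
            (M-cong ψ ≈-refl) ∙-congˡ (cancelˡ (x zero) _ _)
            (λ s j → trans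
              (H-mergeFirst (overwrite (suc zero) (suc (suc l)) x s j))
              (cong (Mψ (x zero) s Sign.*_) (H-cong (mergeFirst-overwrite₁ l x s j))))
            (section-hadamard zero (suc l) (s≤s z≤n) (mergeFirst x))
        -- Neither merged coordinate varies, so the split-off sign is constant.
        section-hadamard {suc m} (suc (suc k)) (suc (suc l)) k<l x =
          hadamard-rows L enum
            {N = section (suc k) (suc l) (mergeFirst x)} {N′ = section (suc (suc k)) (suc (suc l)) x}
            (λ _ → Mψ (x zero) (x (suc zero))) id
            (λ _ → refl) id id
            (λ s j → trans
              (H-mergeFirst (overwrite (suc (suc k)) (suc (suc l)) x s j))
              (cong (Mψ (x zero) (x (suc zero)) Sign.*_) (H-cong (mergeFirst-overwrite₂ k l x s j))))
            (section-hadamard (suc k) (suc l) (s<s⁻¹ k<l) (mergeFirst x))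

        H-isProperHadamard : ∀ {m} → IsProperHadamard L enum (Hᵈ {m})
        H-isProperHadamard k l k≢l a b x with <-cmp k l
        ... | tri< k<l _ _ = section-hadamard k l k<l x a b
        ... | tri≈ _ k≡l _ = contradiction k≡l k≢l
        -- Overwriting at distinct positions commutes, so this section is the transpose of the one
        -- with `k` and `l` interchanged.
        ... | tri> _ _ l<k = hadamard-cong L enum {N = flip (section l k x)} {N′ = section k l x}
          (λ s j → H-cong (λ i → Loop.reflexive L (updateAt-commutes l k (≢-sym k≢l) x i)))
          (hadamard-transpose L enum {N = section l k x}
            (λ s → H-cong ∘ updateAt-const-cong (updateAt x l (const s)) k)
            (section-hadamard l k l<k x))
          a b

corollary17 : ∀ {c ℓ} (L : Loop c ℓ) (n : ℕ) (enum : Enumeration L n)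
    (d : ℕ) (2≤d : 2 ≤ d) (ψ φ : Cochain² L) →
    δ-Compatible L ψ φ →
    IsHadamard L enum (M[_] L φ) →
    IsProperHadamard L enum (H L ψ φ d 2≤d)
corollary17 L n enum (suc (suc m)) (s≤s (s≤s z≤n)) ψ φ compatible hadamard =
  H-isProperHadamard L ψ φ compatible enum hadamard
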